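{- For every positive integer $n$, the integer $C_n=\prod_{k=1}^n(k^3+1)=(1^3+1)(2^3+1)\cdots(n^3+1)$ is not the cube of an integer. -}

module Defs where

open import Data.Nat using (ℕ; zero; suc; _+_; _*_; _^_)

C : ℕ → ℕ
C zero = 1
C (suc n) = C n * (suc n ^ 3 + 1)

{-# OPTIONS --safe #-}

-- Write N = n + 1.  Since k³ + 1 = (k + 1)(k² − k + 1) and k² − k + 1 has no divisor d ≡ 2 (mod 3),
-- a prime p ≡ 2 (mod 3) has the same valuation in C n as in N!.  So if C n is a cube and p² > N,
-- then 3 divides ⌊N / p⌋; in particular there is no such prime in (N/3, N], which a short list of primes
-- refutes for N < 4¹².
--
-- For larger N let m = ⌊N / 12⌋, let A₁ and A₂ be the products of the k ≤ 12m with k ≡ 1 and k ≡ 2 (mod 3),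
-- and consider
--   Q = num m / den m = (12m)! (2m)! (m!)² A₂ / ((6m)!² (4m)! A₁) ≥ 64ᵐ.
-- With t = ⌊12m / q⌋, a prime power q contributes to the factorials in Q the exponent
--   t + ⌊t/6⌋ + 2⌊t/12⌋ − 2⌊t/2⌋ − ⌊t/3⌋ ≤ [t ≡ 1 (mod 3)],
-- and to A₂ / A₁ the exponent −χ(q) [t ≡ 1 (mod 3)], where χ is the nontrivial character modulo 3.
-- So primes p ≡ 1 (mod 3) have nonpositive exponent in Q, and so do the primes p ≡ 2 (mod 3) above √N,
-- because for them t ≢ 1 (mod 3).  Hence only primes of order at most √N are left,
-- and these give Q ≤ N^O(√N), contradicting Q ≥ 64ᵐ.
module Submission where

open import Defs
open import Algebra.Properties.CommutativeSemigroup using (interchange)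
open import Data.Bool using (Bool; true; T; if_then_else_; not; _∧_)
open import Data.Bool.Properties using (T-∧)
open import Data.Empty using (⊥)
open import Data.Integer as ℤ using (ℤ; ∣_∣)
open import Data.Integer.Properties using (abs-*)
open import Data.List.Base using ([]; _∷_)
open import Data.List.Relation.Unary.All using (All; []; _∷_)
open import Data.Nat
open import Data.Nat.Divisibility
open import Data.Nat.DivMod
open import Data.Nat.ListAction using (product)
open import Data.Nat.Primality
open import Data.Nat.Primality.Factorisation using (factorise; module PrimeFactorisation)
open import Data.Nat.Properties
open import Data.Nat.Tactic.RingSolver using (solve-∀)
open import Data.Product using (∃; _×_; _,_)
open import Data.Sum using (_⊎_; inj₁; inj₂; [_,_]′)
open import Function using (_∘_; _$_)
open import Function.Bundles using (Equivalence)
open import Relation.Binary.PropositionalEquality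
  using (_≡_; _≢_; refl; sym; trans; cong; cong₂; subst; subst₂; ≢-sym; module ≡-Reasoning)
open import Relation.Nullary using (¬_; yes; no; does; contradiction)

-- Prime valuations

∑ : (ℕ → ℕ) → ℕ → ℕ
∑ f zero    = 0
∑ f (suc n) = f (suc n) + ∑ f n

∑-cong : ∀ {f g} n → (∀ j → f (suc j) ≡ g (suc j)) → ∑ f n ≡ ∑ g n
∑-cong zero    f≡g = refl
∑-cong (suc n) f≡g = cong₂ _+_ (f≡g n) (∑-cong n f≡g)

∑-mono : ∀ {f g} n → (∀ j → f (suc j) ≤ g (suc j)) → ∑ f n ≤ ∑ g n
∑-mono zero    f≤g = z≤n
∑-mono (suc n) f≤g = +-mono-≤ (f≤g n) (∑-mono n f≤g)

∑-+ : ∀ f g n → ∑ f n + ∑ g n ≡ ∑ (λ j → f j + g j) n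
∑-+ f g zero    = refl
∑-+ f g (suc n) = begin
  f (suc n) + ∑ f n + (g (suc n) + ∑ g n)
    ≡⟨ interchange +-commutativeSemigroup (f (suc n)) (∑ f n) (g (suc n)) (∑ g n) ⟩
  f (suc n) + g (suc n) + (∑ f n + ∑ g n)   ≡⟨ cong (f (suc n) + g (suc n) +_) (∑-+ f g n) ⟩
  ∑ (λ j → f j + g j) (suc n)               ∎
  where open ≡-Reasoning

∑-*ˡ : ∀ c f n → c * ∑ f n ≡ ∑ (λ j → c * f j) n
∑-*ˡ c f zero    = *-zeroʳ c
∑-*ˡ c f (suc n) = trans (*-distribˡ-+ c (f (suc n)) (∑ f n)) (cong (c * f (suc n) +_) (∑-*ˡ c f n))

∑-const : ∀ c n → ∑ (λ _ → c) n ≡ n * c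
∑-const c zero    = refl
∑-const c (suc n) = cong (c +_) (∑-const c n)

∑-zero : ∀ n → ∑ (λ _ → 0) n ≡ 0
∑-zero n = trans (∑-const 0 n) (*-zeroʳ n)

∑-ones : ∀ {f} n → (∀ {j} → j ≤ n → f j ≡ 1) → ∑ f n ≡ n
∑-ones zero    f≡1 = refl
∑-ones (suc n) f≡1 = cong₂ _+_ (f≡1 ≤-refl) (∑-ones n (f≡1 ∘ m≤n⇒m≤1+n))

∑-threshold : ∀ {f e} n → (∀ {j} → j ≤ e → f j ≡ 1) → (∀ {j} → e < j → f j ≡ 0) → e ≤ n → ∑ f n ≡ e
∑-threshold zero    f≡1 f≡0 z≤n = refl
∑-threshold (suc n) f≡1 f≡0 e≤1+n with m≤n⇒m<n∨m≡n e≤1+n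
... | inj₁ e<1+n = cong₂ _+_ (f≡0 e<1+n) (∑-threshold n f≡1 f≡0 (≤-pred e<1+n))
... | inj₂ refl  = ∑-ones (suc n) f≡1

[_∣_] : ℕ → ℕ → ℕ
[ q ∣ n ] = if does (q ∣? n) then 1 else 0

[∣]≡1 : ∀ {q n} → q ∣ n → [ q ∣ n ] ≡ 1
[∣]≡1 {q} {n} q∣n with q ∣? n
... | yes _   = refl
... | no  q∤n = contradiction q∣n q∤n

[∣]≡0 : ∀ {q n} → ¬ q ∣ n → [ q ∣ n ] ≡ 0
[∣]≡0 {q} {n} q∤n with q ∣? n
... | yes q∣n = contradiction q∣n q∤n
... | no  _   = refl

-- The p-adic valuation for p ≥ 2 and n > 0: terms beyond j = n vanish as p ^ j > n.  Junk value: ν p 0 = 0.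
ν : ℕ → ℕ → ℕ
ν p n = ∑ (λ j → [ p ^ j ∣ n ]) n

-- Certifies that `e` is the valuation of `n`. Additivity under products is read off the cofactors,
-- which the sum defining `ν` does not display.
record Exact (p n e : ℕ) : Set where
  constructor exact
  field
    cofactor : ℕ
    n≡p^e*u  : n ≡ p ^ e * cofactor
    p∤u      : ¬ p ∣ cofactor

prime>1 : ∀ {p} → Prime p → 1 < p
prime>1 {p} pp = nonTrivial⇒n>1 p {{prime⇒nonTrivial pp}}

module _ {p : ℕ} (pp : Prime p) where

  private instance
    p≢0 : NonZero p
    p≢0 = prime⇒nonZero pp

  exact-exists : ∀ n → 0 < n → ∃ (Exact p n)
  exact-exists n = go n n ≤-refl
    where
    -- `b` is fuel: dividing out `p` makes the number strictly smaller.
    go : ∀ b n → n ≤ b → 0 < n → ∃ (Exact p n)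
    go zero    n n≤b 0<n = contradiction (≤-trans 0<n n≤b) λ ()
    go (suc b) n n≤b 0<n with p ∣? n
    ... | no p∤n = 0 , exact n (sym (+-identityʳ n)) p∤n
    ... | yes (divides zero n≡0) = contradiction n≡0 (≢-sym (<⇒≢ 0<n))
    ... | yes (divides c@(suc _) refl)
      with go b c (≤-pred (≤-trans (m<m*n c p (prime>1 pp)) n≤b)) z<s
    ...   | e , exact u c≡ p∤u = suc e , exact u eq p∤u
      where
      eq : c * p ≡ p ^ suc e * u
      eq = trans (*-comm c p) (trans (cong (p *_) c≡) (sym (*-assoc p (p ^ e) u)))

  exact-∣ : ∀ {n e j} → Exact p n e → j ≤ e → p ^ j ∣ n
  exact-∣ {n} {e} {j} (exact u refl _) j≤e =
    ∣m⇒∣m*n u (subst (λ k → p ^ j ∣ p ^ k) (m+[n∸m]≡n j≤e)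
      (subst (p ^ j ∣_) (sym (^-distribˡ-+-* p j (e ∸ j))) (m∣m*n (p ^ (e ∸ j)))))

  exact-∤ : ∀ {n e j} → Exact p n e → e < j → ¬ p ^ j ∣ n
  exact-∤ {n} {e} {j} (exact u refl p∤u) e<j pʲ∣n =
    p∤u (*-cancelˡ-∣ (p ^ e) {{m^n≢0 p e}} (∣-trans (subst (_∣ p ^ j) (*-comm p (p ^ e)) p^[1+e]∣pʲ) pʲ∣n))
    where
    p^[1+e]∣pʲ : p ^ suc e ∣ p ^ j
    p^[1+e]∣pʲ = subst (λ k → p ^ suc e ∣ p ^ k) (m+[n∸m]≡n e<j)
      (subst (p ^ suc e ∣_) (sym (^-distribˡ-+-* p (suc e) (j ∸ suc e))) (m∣m*n (p ^ (j ∸ suc e))))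

  ∑-exact : ∀ {n e} J → Exact p n e → e ≤ J → ∑ (λ j → [ p ^ j ∣ n ]) J ≡ e
  ∑-exact J ex = ∑-threshold J ([∣]≡1 ∘ exact-∣ ex) ([∣]≡0 ∘ exact-∤ ex)

  n<p^n : ∀ n → n < p ^ n
  n<p^n zero    = z<s
  n<p^n (suc n) = ≤-trans (s≤s (n<p^n n)) (≤-trans (m<m*n (p ^ n) p {{m^n≢0 p n}} (prime>1 pp))
                    (≤-reflexive (*-comm (p ^ n) p)))

  exact⇒p^e≤n : ∀ {n e} → 0 < n → Exact p n e → p ^ e ≤ n
  exact⇒p^e≤n 0<n ex = ∣⇒≤ {{>-nonZero 0<n}} (exact-∣ ex ≤-refl)

  ν-exact : ∀ {n e} → 0 < n → Exact p n e → ν p n ≡ e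
  ν-exact {n} {e} 0<n ex = ∑-exact n ex (≤-trans (<⇒≤ (n<p^n e)) (exact⇒p^e≤n 0<n ex))

  -- Frees the summation range from `n`: one `J` then serves every factor of a product, and
  -- valuations can be compared power by power.
  ν≡∑ : ∀ {n} J → 0 < n → n < p ^ suc J → ν p n ≡ ∑ (λ j → [ p ^ j ∣ n ]) J
  ν≡∑ {n} J 0<n n<p^[1+J] with exact-exists n 0<n
  ... | e , ex = trans (ν-exact 0<n ex) (sym (∑-exact J ex (≮⇒≥ λ J<e →
    <⇒≱ n<p^[1+J] (≤-trans (^-monoʳ-≤ p J<e) (exact⇒p^e≤n 0<n ex)))))

  exact-* : ∀ {a b e f} → Exact p a e → Exact p b f → Exact p (a * b) (e + f)
  exact-* {e = e} {f} (exact u refl p∤u) (exact v refl p∤v) = exact (u * v) eq ([ p∤u , p∤v ]′ ∘ euclidsLemma u v pp)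
    where
    eq : p ^ e * u * (p ^ f * v) ≡ p ^ (e + f) * (u * v)
    eq = trans ([m*n]*[o*p]≡[m*o]*[n*p] (p ^ e) u (p ^ f) v)
               (cong (_* (u * v)) (sym (^-distribˡ-+-* p e f)))

  ν-* : ∀ {a b} → 0 < a → 0 < b → ν p (a * b) ≡ ν p a + ν p b
  ν-* {a} {b} 0<a 0<b with exact-exists a 0<a | exact-exists b 0<b
  ... | e , ex | f , fx = trans (ν-exact (*-mono-≤ 0<a 0<b) (exact-* ex fx))
                            (sym (cong₂ _+_ (ν-exact 0<a ex) (ν-exact 0<b fx)))

  ν-∤ : ∀ {n} → 0 < n → ¬ p ∣ n → ν p n ≡ 0
  ν-∤ {n} 0<n p∤n = ν-exact 0<n (exact n (sym (+-identityʳ n)) p∤n)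

  ν-1 : ν p 1 ≡ 0
  ν-1 = ν-∤ z<s λ p∣1 → <⇒≱ (prime>1 pp) (∣⇒≤ p∣1)

  ν-∣ : ∀ {n} → 0 < n → p ∣ n → 0 < ν p n
  ν-∣ {n} 0<n p∣n with exact-exists n 0<n
  ... | suc e , ex = subst (0 <_) (sym (ν-exact 0<n ex)) z<s
  ... | zero , exact u refl p∤u = contradiction (subst (p ∣_) (+-identityʳ u) p∣n) p∤u

  ν>0⇒∣ : ∀ {n} → 0 < n → 0 < ν p n → p ∣ n
  ν>0⇒∣ {n} 0<n 0<ν with p ∣? n
  ... | yes p∣n = p∣n
  ... | no  p∤n = contradiction (ν-∤ 0<n p∤n) (≢-sym (<⇒≢ 0<ν))

  ν-^ : ∀ {a} → 0 < a → ∀ k → ν p (a ^ k) ≡ k * ν p a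
  ν-^ 0<a zero    = ν-1
  ν-^ {a} 0<a (suc k) = trans (ν-* 0<a (m^n>0 a {{>-nonZero 0<a}} k)) (cong (ν p a +_) (ν-^ 0<a k))

-- Strip the prime factors of `m` one at a time: each has positive valuation in `n`, hence divides
-- it, and cancels on both sides. This turns bounds on exponents into a bound on size.
ν-≤⇒≤ : ∀ {m n} → 0 < m → 0 < n → (∀ {p} → Prime p → ν p m ≤ ν p n) → m ≤ n
ν-≤⇒≤ {m} {n} 0<m 0<n ν≤ = subst (_≤ n) (sym m≡) (go (PrimeFactorisation.factors fac) n
    (PrimeFactorisation.factorsPrime fac) 0<n λ {p} pp → subst (λ k → ν p k ≤ ν p n) m≡ (ν≤ pp))
  where
  fac = factorise m {{>-nonZero 0<m}}
  m≡  = PrimeFactorisation.isFactorisation fac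
  go : ∀ ps n → All Prime ps → 0 < n → (∀ {p} → Prime p → ν p (product ps) ≤ ν p n) → product ps ≤ n
  go []       n []         0<n ν≤ = 0<n
  go (q ∷ qs) n (pq ∷ pqs) 0<n ν≤ with ν>0⇒∣ pq 0<n (≤-trans
      (ν-∣ pq (*-mono-≤ 0<q (productOfPrimes≥1 pqs)) (m∣m*n (product qs))) (ν≤ pq))
    where 0<q = <-trans z<s (prime>1 pq)
  ... | divides zero n≡0 = contradiction n≡0 (≢-sym (<⇒≢ 0<n))
  ... | divides c@(suc _) refl = ≤-trans (*-monoʳ-≤ q (go qs c pqs z<s λ {p} pp →
        +-cancelˡ-≤ (ν p q) _ _ (subst₂ _≤_ (ν-* pp 0<q (productOfPrimes≥1 pqs))
          (trans (ν-* pp {c} {q} z<s 0<q) (+-comm (ν p c) (ν p q))) (ν≤ pp))))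
        (≤-reflexive (*-comm q c))
    where 0<q = <-trans z<s (prime>1 pq)

-- Products over residue classes modulo 3

-- The indicators of the classes 1 and 2 modulo 3; their difference is the character χ. Recursion by
-- threes makes the periodicity definitional.
χ₁ χ₂ : ℕ → ℕ
χ₁ 0 = 0
χ₁ 1 = 1
χ₁ 2 = 0
χ₁ (suc (suc (suc n))) = χ₁ n
χ₂ 0 = 0
χ₂ 1 = 0
χ₂ 2 = 1
χ₂ (suc (suc (suc n))) = χ₂ n

data Mod3 : ℕ → Set where
  residue₀ : ∀ a → Mod3 (a * 3)
  residue₁ : ∀ a → Mod3 (1 + a * 3)
  residue₂ : ∀ a → Mod3 (2 + a * 3)

mod3 : ∀ n → Mod3 n
mod3 0 = residue₀ 0
mod3 1 = residue₁ 0
mod3 2 = residue₂ 0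
mod3 (suc (suc (suc n))) with mod3 n
... | residue₀ a = residue₀ (suc a)
... | residue₁ a = residue₁ (suc a)
... | residue₂ a = residue₂ (suc a)

periodic : ∀ {f : ℕ → ℕ} → (∀ n → f (3 + n) ≡ f n) → ∀ n a → f (n + a * 3) ≡ f n
periodic {f} per n zero    = cong f (+-identityʳ n)
periodic {f} per n (suc a) = trans (cong f (trans (sym (+-assoc n 3 (a * 3))) (cong (_+ a * 3) (+-comm n 3))))
  (trans (per (n + a * 3)) (periodic {f} per n a))

χ₁-+*3 : ∀ n a → χ₁ (n + a * 3) ≡ χ₁ n
χ₁-+*3 = periodic λ _ → refl

χ₂-+*3 : ∀ n a → χ₂ (n + a * 3) ≡ χ₂ n
χ₂-+*3 = periodic λ _ → refl

χ₁-*2 : ∀ i → χ₁ (i * 2) ≡ χ₂ i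
χ₁-*2 0 = refl
χ₁-*2 1 = refl
χ₁-*2 2 = refl
χ₁-*2 (suc (suc (suc i))) = χ₁-*2 i

χ₂-*2 : ∀ i → χ₂ (i * 2) ≡ χ₁ i
χ₂-*2 0 = refl
χ₂-*2 1 = refl
χ₂-*2 2 = refl
χ₂-*2 (suc (suc (suc i))) = χ₂-*2 i

χ₂-suc : ∀ t → χ₂ (suc t) ≡ χ₁ t
χ₂-suc 0 = refl
χ₂-suc 1 = refl
χ₂-suc 2 = refl
χ₂-suc (suc (suc (suc t))) = χ₂-suc t

χ₁≤1 : ∀ t → χ₁ t ≤ 1
χ₁≤1 0 = z≤n
χ₁≤1 1 = ≤-refl
χ₁≤1 2 = z≤n
χ₁≤1 (suc (suc (suc t))) = χ₁≤1 t

-- Counting up from 1, the classes 1 and 2 alternate, so class 1 is ahead by one exactly when t ≡ 1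
-- (mod 3).
∑χ₁≡∑χ₂+χ₁ : ∀ t → ∑ χ₁ t ≡ ∑ χ₂ t + χ₁ t
∑χ₁≡∑χ₂+χ₁ zero    = refl
∑χ₁≡∑χ₂+χ₁ (suc t) = begin
  χ₁ (suc t) + ∑ χ₁ t                ≡⟨ +-comm (χ₁ (suc t)) (∑ χ₁ t) ⟩
  ∑ χ₁ t + χ₁ (suc t)                ≡⟨ cong (_+ χ₁ (suc t)) (∑χ₁≡∑χ₂+χ₁ t) ⟩
  ∑ χ₂ t + χ₁ t + χ₁ (suc t)         ≡⟨ cong (_+ χ₁ (suc t)) (+-comm (∑ χ₂ t) (χ₁ t)) ⟩
  χ₁ t + ∑ χ₂ t + χ₁ (suc t)         ≡⟨ cong (λ x → x + ∑ χ₂ t + χ₁ (suc t)) (χ₂-suc t) ⟨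
  χ₂ (suc t) + ∑ χ₂ t + χ₁ (suc t)   ∎
  where open ≡-Reasoning

-- The product of `k ^ f k` over 1 ≤ k ≤ n: a factorial for the constant weight 1, and A₁ and A₂ for
-- `χ₁` and `χ₂` at n = 12m.
W : (ℕ → ℕ) → ℕ → ℕ
W f zero    = 1
W f (suc n) = suc n ^ f (suc n) * W f n

W>0 : ∀ f n → 0 < W f n
W>0 f zero    = z<s
W>0 f (suc n) = *-mono-≤ (m^n>0 (suc n) (f (suc n))) (W>0 f n)

W-const1 : ∀ n → W (λ _ → 1) n ≡ n !
W-const1 zero    = refl
W-const1 (suc n) = cong₂ _*_ (*-identityʳ (suc n)) (W-const1 n)

H : (ℕ → ℕ) → ℕ → ℕ → ℕ
H f n q = ∑ (λ k → f k * [ q ∣ k ]) n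

-- Legendre's formula with weights: `k` counts `f k` times for each j ≥ 1 such that `p ^ j` divides
-- `k`.
ν-W : ∀ {p} (pp : Prime p) f n J → n < p ^ suc J → ν p (W f n) ≡ ∑ (λ j → H f n (p ^ j)) J
ν-W pp f zero    J n<  = trans (ν-1 pp) (sym (∑-zero J))
ν-W {p} pp f (suc n) J n< = begin
  ν p (suc n ^ f (suc n) * W f n)                          ≡⟨ ν-* pp (m^n>0 (suc n) (f (suc n))) (W>0 f n) ⟩
  ν p (suc n ^ f (suc n)) + ν p (W f n)
    ≡⟨ cong₂ _+_ (ν-^ pp z<s (f (suc n))) (ν-W pp f n J (<-trans ≤-refl n<)) ⟩
  f (suc n) * ν p (suc n) + ∑ (λ j → H f n (p ^ j)) J
    ≡⟨ cong (λ x → f (suc n) * x + ∑ (λ j → H f n (p ^ j)) J) (ν≡∑ pp J z<s n<) ⟩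
  f (suc n) * ∑ (λ j → [ p ^ j ∣ suc n ]) J + ∑ (λ j → H f n (p ^ j)) J
    ≡⟨ cong (_+ ∑ (λ j → H f n (p ^ j)) J) (∑-*ˡ (f (suc n)) _ J) ⟩
  ∑ (λ j → f (suc n) * [ p ^ j ∣ suc n ]) J + ∑ (λ j → H f n (p ^ j)) J ≡⟨ ∑-+ _ _ J ⟩
  ∑ (λ j → H f (suc n) (p ^ j)) J  ∎
  where open ≡-Reasoning

H-multiples : ∀ f n q .{{_ : NonZero q}} → H f n q ≡ ∑ (λ i → f (i * q)) (n / q)
H-multiples f n (suc q) = trans (cong (λ k → H f k (suc q)) (m≡m%n+[m/n]*n n (suc q)))
                                (go (n / suc q) (n % suc q) (m%n<n n (suc q)))
  where
  go : ∀ t r → r < suc q → H f (r + t * suc q) (suc q) ≡ ∑ (λ i → f (i * suc q)) t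
  go t (suc r) 1+r<q = begin
    f k * [ suc q ∣ k ] + H f (r + t * suc q) (suc q)
      ≡⟨ cong (λ x → f k * x + H f (r + t * suc q) (suc q)) ([∣]≡0 q∤k) ⟩
    f k * 0 + H f (r + t * suc q) (suc q)             ≡⟨ cong (_+ H f (r + t * suc q) (suc q)) (*-zeroʳ (f k)) ⟩
    H f (r + t * suc q) (suc q)                       ≡⟨ go t r (<-trans ≤-refl 1+r<q) ⟩
    ∑ (λ i → f (i * suc q)) t                         ∎
    where
    open ≡-Reasoning
    k = suc r + t * suc q
    q∤k : ¬ suc q ∣ k
    q∤k q∣k = <⇒≱ 1+r<q (∣⇒≤ (∣m+n∣m⇒∣n (subst (suc q ∣_) (+-comm (suc r) (t * suc q)) q∣k) (divides t refl)))
  go zero    zero r<q = refl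
  -- `suc t * suc q` is the successor of `q + t * suc q`, so below a multiple the remainder restarts
  -- at `q`.
  go (suc t) zero r<q = cong₂ _+_
    (trans (cong (f (suc t * suc q) *_) ([∣]≡1 {suc q} (divides (suc t) refl))) (*-identityʳ (f (suc t * suc q))))
    (go t q ≤-refl)

H-factorial : ∀ n q .{{_ : NonZero q}} → H (λ _ → 1) n q ≡ n / q
H-factorial n q = trans (H-multiples (λ _ → 1) n q) (trans (∑-const 1 (n / q)) (*-identityʳ (n / q)))

H-χ : ∀ f g n q .{{_ : NonZero q}} → (∀ i → f (i * q) ≡ g i) → H f n q ≡ ∑ g (n / q)
H-χ f g n q f≡g = trans (H-multiples f n q) (∑-cong (n / q) (λ j → f≡g (suc j)))

*[1+a*3] : ∀ i a → i * (1 + a * 3) ≡ i + i * a * 3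
*[1+a*3] i a = trans (*-suc i (a * 3)) (cong (i +_) (sym (*-assoc i a 3)))

*[2+a*3] : ∀ i a → i * (2 + a * 3) ≡ i * 2 + i * a * 3
*[2+a*3] i a = trans (*-distribˡ-+ i 2 (a * 3)) (cong (i * 2 +_) (sym (*-assoc i a 3)))

module _ (n : ℕ) where

  -- Multiplication by q ≡ 1 preserves the residue classes, so the two sums over multiples of q
  -- differ by the surplus of class 1 up to n / q.
  H-χ₁-1 : ∀ a → H χ₁ n (1 + a * 3) ≡ H χ₂ n (1 + a * 3) + χ₁ (n / (1 + a * 3))
  H-χ₁-1 a = begin
    H χ₁ n q                     ≡⟨ H-χ χ₁ χ₁ n q (λ i → trans (cong χ₁ (*[1+a*3] i a)) (χ₁-+*3 i (i * a))) ⟩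
    ∑ χ₁ (n / q)                 ≡⟨ ∑χ₁≡∑χ₂+χ₁ (n / q) ⟩
    ∑ χ₂ (n / q) + χ₁ (n / q)
      ≡⟨ cong (_+ χ₁ (n / q)) (H-χ χ₂ χ₂ n q (λ i → trans (cong χ₂ (*[1+a*3] i a)) (χ₂-+*3 i (i * a)))) ⟨
    H χ₂ n q + χ₁ (n / q)        ∎
    where open ≡-Reasoning; q = 1 + a * 3

  -- Multiplication by q ≡ 2 exchanges the classes 1 and 2, so the surplus changes sides.
  H-χ₂-2 : ∀ a → H χ₂ n (2 + a * 3) ≡ H χ₁ n (2 + a * 3) + χ₁ (n / (2 + a * 3))
  H-χ₂-2 a = begin
    H χ₂ n q
      ≡⟨ H-χ χ₂ χ₁ n q (λ i → trans (cong χ₂ (*[2+a*3] i a)) (trans (χ₂-+*3 (i * 2) (i * a)) (χ₂-*2 i))) ⟩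
    ∑ χ₁ (n / q)                 ≡⟨ ∑χ₁≡∑χ₂+χ₁ (n / q) ⟩
    ∑ χ₂ (n / q) + χ₁ (n / q)
      ≡⟨ cong (_+ χ₁ (n / q)) (H-χ χ₁ χ₂ n q (λ i →
           trans (cong χ₁ (*[2+a*3] i a)) (trans (χ₁-+*3 (i * 2) (i * a)) (χ₁-*2 i)))) ⟨
    H χ₁ n q + χ₁ (n / q)        ∎
    where open ≡-Reasoning; q = 2 + a * 3

  H-χ₂-0 : ∀ a .{{_ : NonZero (a * 3)}} → H χ₂ n (a * 3) ≡ 0
  H-χ₂-0 a = trans (H-χ χ₂ (λ _ → 0) n (a * 3) (λ i → trans (cong χ₂ (sym (*-assoc i a 3))) (χ₂-+*3 0 (i * a))))
                   (∑-zero (n / (a * 3)))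

  H-χ₂≤H-χ₁+χ₁ : ∀ q .{{_ : NonZero q}} → H χ₂ n q ≤ H χ₁ n q + χ₁ (n / q)
  H-χ₂≤H-χ₁+χ₁ q with mod3 q
  ... | residue₀ a = ≤-trans (≤-reflexive (H-χ₂-0 a)) z≤n
  ... | residue₁ a = ≤-trans (≤-trans (m≤m+n _ _) (≤-reflexive (sym (H-χ₁-1 a)))) (m≤m+n _ _)
  ... | residue₂ a = ≤-reflexive (H-χ₂-2 a)

-- Exponents of prime powers in the factorial quotient

floors : ∀ t → t + (t / 6 + (t / 12 + t / 12)) ≤ t / 2 + t / 2 + t / 3 + χ₁ t
floors 0 = z≤n
floors 1 = ≤ᵇ⇒≤ _ _ _
floors 2 = ≤ᵇ⇒≤ _ _ _
floors 3 = ≤ᵇ⇒≤ _ _ _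
floors 4 = ≤ᵇ⇒≤ _ _ _
floors 5 = ≤ᵇ⇒≤ _ _ _
floors 6 = ≤ᵇ⇒≤ _ _ _
floors 7 = ≤ᵇ⇒≤ _ _ _
floors 8 = ≤ᵇ⇒≤ _ _ _
floors 9 = ≤ᵇ⇒≤ _ _ _
floors 10 = ≤ᵇ⇒≤ _ _ _
floors 11 = ≤ᵇ⇒≤ _ _ _
-- Raising `t` by 12 adds 16 to both sides, as 12 + 2 + 2 on the left and 6 + 6 + 4 on the right, so
-- one period of cases suffices.
floors (suc (suc (suc (suc (suc (suc (suc (suc (suc (suc (suc (suc t)))))))))))) = begin
  12 + t + ((12 + t) / 6 + ((12 + t) / 12 + (12 + t) / 12))
    ≡⟨ cong₂ (λ a b → 12 + t + (a + (b + b))) (+-distrib-/-∣ˡ t {6} (divides 2 refl))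
             (+-distrib-/-∣ˡ t {12} (divides 1 refl)) ⟩
  12 + t + (2 + t / 6 + (1 + t / 12 + (1 + t / 12))) ≡⟨ shuffle₁ t (t / 6) (t / 12) ⟩
  16 + (t + (t / 6 + (t / 12 + t / 12)))         ≤⟨ +-monoʳ-≤ 16 (floors t) ⟩
  16 + (t / 2 + t / 2 + t / 3 + χ₁ t)            ≡⟨ shuffle₂ (t / 2) (t / 3) (χ₁ t) ⟩
  6 + t / 2 + (6 + t / 2) + (4 + t / 3) + χ₁ t
    ≡⟨ cong₂ (λ a b → a + a + b + χ₁ t) (+-distrib-/-∣ˡ t {2} (divides 6 refl))
             (+-distrib-/-∣ˡ t {3} (divides 4 refl)) ⟨
  (12 + t) / 2 + (12 + t) / 2 + (12 + t) / 3 + χ₁ t ∎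
  where
  open ≤-Reasoning
  shuffle₁ : ∀ t a b → 12 + t + (2 + a + (1 + b + (1 + b))) ≡ 16 + (t + (a + (b + b)))
  shuffle₁ = solve-∀
  shuffle₂ : ∀ a b c → 16 + (a + a + b + c) ≡ 6 + a + (6 + a) + (4 + b) + c
  shuffle₂ = solve-∀

private
  _‼_ : ℕ → ℕ → ℕ
  _‼_ = H (λ _ → 1)

numExp denExp : ℕ → ℕ → ℕ
numExp m q = (m * 12) ‼ q + ((m * 2) ‼ q + (m ‼ q + m ‼ q)) + H χ₂ (m * 12) q
denExp m q = (m * 6) ‼ q + (m * 6) ‼ q + (m * 4) ‼ q + H χ₁ (m * 12) q

module _ (m q : ℕ) .{{_ : NonZero q}} where

  private
    t = m * 12 / q

  -- Nested floors: dividing by `b` and by `q` commutes, so every factorial exponent depends on `t`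
  -- alone.
  factorial-quotient : ∀ a b .{{_ : NonZero b}} → a * b ≡ m * 12 → a ‼ q ≡ t / b
  factorial-quotient a b eq = begin
    a ‼ q             ≡⟨ H-factorial a q ⟩
    a / q             ≡⟨ cong (_/ q) (m*n/n≡m a b) ⟨
    a * b / b / q     ≡⟨ cong (λ x → x / b / q) eq ⟩
    m * 12 / b / q    ≡⟨ m/n/o≡m/[n*o] (m * 12) b q ⟩
    m * 12 / (b * q)  ≡⟨ /-congʳ (*-comm b q) ⟩
    m * 12 / (q * b)  ≡⟨ m/n/o≡m/[n*o] (m * 12) q b ⟨
    m * 12 / q / b    ∎
    where
    open ≡-Reasoning
    instance _ = m*n≢0 b q
             _ = m*n≢0 q b

  exponents : numExp m q + H χ₁ (m * 12) q ≤ denExp m q + χ₁ t + H χ₂ (m * 12) q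
  exponents = begin
    A + h₂ + h₁            ≡⟨ cong (λ x → x + h₂ + h₁) A≡ ⟩
    _ + h₂ + h₁            ≤⟨ +-monoˡ-≤ h₁ (+-monoˡ-≤ h₂ (floors t)) ⟩
    _ + χ₁ t + h₂ + h₁     ≡⟨ shuffle _ (χ₁ t) h₂ h₁ ⟩
    _ + h₁ + χ₁ t + h₂     ≡⟨ cong (λ x → x + h₁ + χ₁ t + h₂) B≡ ⟨
    B + h₁ + χ₁ t + h₂     ∎
    where
    open ≤-Reasoning
    h₁ = H χ₁ (m * 12) q
    h₂ = H χ₂ (m * 12) q
    A = (m * 12) ‼ q + ((m * 2) ‼ q + (m ‼ q + m ‼ q))
    B = (m * 6) ‼ q + (m * 6) ‼ q + (m * 4) ‼ q
    m‼q = factorial-quotient m 12 refl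
    A≡ : A ≡ t + (t / 6 + (t / 12 + t / 12))
    A≡ = cong₂ _+_ (H-factorial (m * 12) q)
           (cong₂ _+_ (factorial-quotient (m * 2) 6 (*-assoc m 2 6)) (cong₂ _+_ m‼q m‼q))
    B≡ : B ≡ t / 2 + t / 2 + t / 3
    B≡ = cong₂ _+_ (cong₂ _+_ [m6] [m6]) (factorial-quotient (m * 4) 3 (*-assoc m 4 3))
      where [m6] = factorial-quotient (m * 6) 2 (*-assoc m 6 2)
    shuffle : ∀ a b c d → a + b + c + d ≡ a + d + b + c
    shuffle = solve-∀

  -- One `χ₁ t` comes from `floors`, the other from the possible surplus of class 2 among the
  -- multiples of `q`.
  numExp≤denExp+2χ₁ : numExp m q ≤ denExp m q + (χ₁ t + χ₁ t)
  numExp≤denExp+2χ₁ = +-cancelʳ-≤ (H χ₁ (m * 12) q) _ _ (begin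
    numExp m q + H χ₁ (m * 12) q                      ≤⟨ exponents ⟩
    denExp m q + χ₁ t + H χ₂ (m * 12) q               ≤⟨ +-monoʳ-≤ (denExp m q + χ₁ t) (H-χ₂≤H-χ₁+χ₁ (m * 12) q) ⟩
    denExp m q + χ₁ t + (H χ₁ (m * 12) q + χ₁ t)      ≡⟨ shuffle (denExp m q) (χ₁ t) _ ⟩
    denExp m q + (χ₁ t + χ₁ t) + H χ₁ (m * 12) q      ∎)
    where
    open ≤-Reasoning
    shuffle : ∀ a b c → a + b + (c + b) ≡ a + (b + b) + c
    shuffle = solve-∀

-- For q ≡ 1 the surplus of class 1 in the denominator cancels the `χ₁ t` from `floors`.
numExp≤denExp : ∀ m a → numExp m (1 + a * 3) ≤ denExp m (1 + a * 3)
numExp≤denExp m a = +-cancelʳ-≤ (χ₁ t + H χ₂ (m * 12) q) _ _ (begin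
    numExp m q + (χ₁ t + H χ₂ (m * 12) q)   ≡⟨ cong (numExp m q +_) (trans (+-comm (χ₁ t) _) (sym (H-χ₁-1 (m * 12) a))) ⟩
    numExp m q + H χ₁ (m * 12) q            ≤⟨ exponents m q ⟩
    denExp m q + χ₁ t + H χ₂ (m * 12) q     ≡⟨ +-assoc (denExp m q) (χ₁ t) _ ⟩
    denExp m q + (χ₁ t + H χ₂ (m * 12) q)   ∎)
  where
  open ≤-Reasoning
  q = 1 + a * 3
  t = m * 12 / q

-- Lower bound for the factorial quotient

-- The product (x + 1)⋯(x + k), that is, (x + k)! / x!.
rise : ℕ → ℕ → ℕ
rise zero    x = 1
rise (suc k) x = (suc k + x) * rise k x

rise-! : ∀ k x → (k + x) ! ≡ rise k x * x !
rise-! zero    x = sym (+-identityʳ (x !))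
rise-! (suc k) x = trans (cong ((suc k + x) *_) (rise-! k x)) (sym (*-assoc (suc k + x) (rise k x) (x !)))

-- What is left of (6m + 1)⋯(6m + 6), and of the odd numbers between 12m and 12m + 12, after
-- removing constants and the factors shared with the other factorials.
quartic₁ quartic₂ : ℕ → ℕ
quartic₁ m = (1 + m * 6) * (5 + m * 6) * ((1 + m * 3) * (2 + m * 3))
quartic₂ m = (1 + m * 12) * (5 + m * 12) * ((7 + m * 12) * (11 + m * 12))

quintic≤ : ∀ m → 32 * (quartic₁ m * (1 + m * 2)) ≤ quartic₂ m * (1 + m)
quintic≤ m = m+n≤o⇒m≤o (32 * (quartic₁ m * (1 + m * 2))) (≤-reflexive (expand m))
  -- Both sides have leading coefficient 12⁴, and their difference has only positive coefficients.
  where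
  expand : ∀ m → 32 * ((1 + m * 6) * (5 + m * 6) * ((1 + m * 3) * (2 + m * 3)) * (1 + m * 2))
             + (10368 * m * m * m * m + 19872 * m * m * m + 12384 * m * m + 2625 * m + 65)
     ≡ (1 + m * 12) * (5 + m * 12) * ((7 + m * 12) * (11 + m * 12)) * (1 + m)
  expand = solve-∀

rise-6 : ∀ m → rise 6 (m * 6) ≡ 72 * ((1 + m) * (1 + m * 2)) * quartic₁ m
rise-6 = expand
  where
  expand : ∀ m → (6 + m * 6) * ((5 + m * 6) * ((4 + m * 6) * ((3 + m * 6) * ((2 + m * 6) * ((1 + m * 6) * 1)))))
         ≡ 72 * ((1 + m) * (1 + m * 2)) * ((1 + m * 6) * (5 + m * 6) * ((1 + m * 3) * (2 + m * 3)))
  expand = solve-∀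

rise-4 : ∀ m → rise 4 (m * 4) ≡ 8 * ((1 + m) * (1 + m * 2)) * ((1 + m * 4) * (3 + m * 4))
rise-4 = expand
  where
  expand : ∀ m → (4 + m * 4) * ((3 + m * 4) * ((2 + m * 4) * ((1 + m * 4) * 1)))
         ≡ 8 * ((1 + m) * (1 + m * 2)) * ((1 + m * 4) * (3 + m * 4))
  expand = solve-∀

odds : ℕ → ℕ → ℕ
odds zero    x = 1
odds (suc k) x = (1 + (k + x) * 2) * odds k x

-- The even factors halve to `rise k x`; the odd ones form `odds k x`.
rise-*2 : ∀ k x → rise (k * 2) (x * 2) ≡ 2 ^ k * rise k x * odds k x
rise-*2 zero    x = refl
rise-*2 (suc k) x = begin
  (2 + (k * 2 + x * 2)) * ((1 + (k * 2 + x * 2)) * rise (k * 2) (x * 2))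
    ≡⟨ cong₂ (λ a b → (2 + a) * ((1 + a) * b)) (sym (*-distribʳ-+ 2 k x)) (rise-*2 k x) ⟩
  (2 + (k + x) * 2) * ((1 + (k + x) * 2) * (2 ^ k * rise k x * odds k x))
    ≡⟨ shuffle (k + x) (2 ^ k) (rise k x) (odds k x) ⟩
  2 * 2 ^ k * ((1 + (k + x)) * rise k x) * ((1 + (k + x) * 2) * odds k x) ∎
  where
  open ≡-Reasoning
  shuffle : ∀ a b c d → (2 + a * 2) * ((1 + a * 2) * (b * c * d)) ≡ 2 * b * ((1 + a) * c) * ((1 + a * 2) * d)
  shuffle = solve-∀

odds-6 : ∀ m → odds 6 (m * 6) ≡ 9 * ((1 + m * 4) * (3 + m * 4)) * quartic₂ m
odds-6 = expand
  where
  expand : ∀ m → (1 + (5 + m * 6) * 2) * ((1 + (4 + m * 6) * 2) * ((1 + (3 + m * 6) * 2)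
                   * ((1 + (2 + m * 6) * 2) * ((1 + (1 + m * 6) * 2) * ((1 + (0 + m * 6) * 2) * 1)))))
       ≡ 9 * ((1 + m * 4) * (3 + m * 4)) * ((1 + m * 12) * (5 + m * 12) * ((7 + m * 12) * (11 + m * 12)))
  expand = solve-∀

rise-2 : ∀ m → rise 2 (m * 2) ≡ 2 * (1 + m) * (1 + m * 2)
rise-2 = expand
  where
  expand : ∀ m → (2 + m * 2) * ((1 + m * 2) * 1) ≡ 2 * (1 + m) * (1 + m * 2)
  expand = solve-∀

rise-1 : ∀ m → rise 1 m ≡ 1 + m
rise-1 m = *-identityʳ (1 + m)

rise-double : ∀ {k x} l y → k ≡ l * 2 → x ≡ y * 2 → rise k x ≡ 2 ^ l * rise l y * odds l y
rise-double l y refl refl = rise-*2 l y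

rise-12 : ∀ m → rise 12 (m * 12) ≡ 2 ^ 6 * rise 6 (m * 6) * odds 6 (m * 6)
rise-12 m = rise-double {12} {m * 12} 6 (m * 6) refl (sym (*-assoc m 6 2))

-- Stated for variables: comparing applications of rise at numerals by unfolding does not terminate in practice.
step-core : ∀ {r r₁ r₂ r₄ r₁₂ o e a b c d w} → e ≡ 64 →
            r₁ ≡ a → r₂ ≡ 2 * a * b → r₄ ≡ 8 * (a * b) * w → r ≡ 72 * (a * b) * c →
            o ≡ 9 * w * d → r₁₂ ≡ e * r * o → 32 * (c * b) ≤ d * a →
            r * r * r₄ * 64 ≤ r₁₂ * (r₂ * (r₁ * r₁))
step-core {r} {a = a} {b} {c} {d} {w} refl refl refl refl r≡ refl refl cb≤da = begin
  r * r * (8 * (a * b) * w) * 64                          ≡⟨ cong (λ x → r * x * (8 * (a * b) * w) * 64) r≡ ⟩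
  r * (72 * (a * b) * c) * (8 * (a * b) * w) * 64         ≡⟨ shuffle₁ 64 r a b c w ⟩
  64 * r * w * (18 * (b * (a * a))) * (32 * (c * b))      ≤⟨ *-monoʳ-≤ (64 * r * w * (18 * (b * (a * a)))) cb≤da ⟩
  64 * r * w * (18 * (b * (a * a))) * (d * a)             ≡⟨ shuffle₂ 64 r a b w d ⟩
  64 * r * (9 * w * d) * (2 * a * b * (a * a))            ∎
  where
  open ≤-Reasoning
  shuffle₁ : ∀ s r a b c w → r * (72 * (a * b) * c) * (8 * (a * b) * w) * s
           ≡ s * r * w * (18 * (b * (a * a))) * (32 * (c * b))
  shuffle₁ = solve-∀
  shuffle₂ : ∀ s r a b w d → s * r * w * (18 * (b * (a * a))) * (d * a)
           ≡ s * r * (9 * w * d) * (2 * a * b * (a * a))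
  shuffle₂ = solve-∀

growth-step : ∀ m → rise 6 (m * 6) * rise 6 (m * 6) * rise 4 (m * 4) * 64
                  ≤ rise 12 (m * 12) * (rise 2 (m * 2) * (rise 1 m * rise 1 m))
growth-step m = step-core {a = 1 + m} {b = 1 + m * 2} {c = quartic₁ m} {d = quartic₂ m}
  {w = (1 + m * 4) * (3 + m * 4)}
  refl (rise-1 m) (rise-2 m) (rise-4 m) (rise-6 m) (odds-6 m) (rise-12 m) (quintic≤ m)

-- The ratio of consecutive quotients tends to 12¹² 2² / (6¹² 4⁴) = 64 and is never below it.
growth : ∀ m → (m * 6) ! * (m * 6) ! * (m * 4) ! * 64 ^ m ≤ (m * 12) ! * ((m * 2) ! * (m ! * m !))
growth zero    = ≤-refl
growth (suc m) = begin
  (6 + m * 6) ! * (6 + m * 6) ! * (4 + m * 4) ! * (64 * 64 ^ m)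
    ≡⟨ cong₂ (λ x y → x * x * y * (64 * 64 ^ m)) (rise-! 6 (m * 6)) (rise-! 4 (m * 4)) ⟩
  r₆ * (m * 6) ! * (r₆ * (m * 6) !) * (r₄ * (m * 4) !) * (64 * 64 ^ m)
    ≡⟨ shuffle₁ r₆ ((m * 6) !) r₄ ((m * 4) !) (64 ^ m) ⟩
  r₆ * r₆ * r₄ * 64 * ((m * 6) ! * (m * 6) ! * (m * 4) ! * 64 ^ m)
    ≤⟨ *-mono-≤ (growth-step m) (growth m) ⟩
  r₁₂ * (r₂ * (r₁ * r₁)) * ((m * 12) ! * ((m * 2) ! * (m ! * m !)))
    ≡⟨ shuffle₂ r₁₂ r₂ r₁ ((m * 12) !) ((m * 2) !) (m !) ⟩
  r₁₂ * (m * 12) ! * (r₂ * (m * 2) ! * (r₁ * m ! * (r₁ * m !)))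
    ≡⟨ cong₂ _*_ (rise-! 12 (m * 12)) (cong₂ (λ x y → x * (y * y)) (rise-! 2 (m * 2)) (rise-! 1 m)) ⟨
  (12 + m * 12) ! * ((2 + m * 2) ! * ((1 + m) ! * (1 + m) !)) ∎
  where
  open ≤-Reasoning
  r₁ = rise 1 m
  r₂ = rise 2 (m * 2)
  r₄ = rise 4 (m * 4)
  r₆ = rise 6 (m * 6)
  r₁₂ = rise 12 (m * 12)
  shuffle₁ : ∀ r x s y z → r * x * (r * x) * (s * y) * (64 * z) ≡ r * r * s * 64 * (x * x * y * z)
  shuffle₁ = solve-∀
  shuffle₂ : ∀ r s t x y z → r * (s * (t * t)) * (x * (y * (z * z))) ≡ r * x * (s * y * (t * z * (t * z)))
  shuffle₂ = solve-∀

-- Each factor 3i + 1 on the left is paired with 3i + 2 on the right.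
W-χ≤ : ∀ n → W χ₁ (n * 3) ≤ W χ₂ (n * 3)
W-χ≤ zero    = ≤-refl
W-χ≤ (suc n) = begin
  k 3 ^ χ₁ (n * 3) * (k 2 ^ χ₁ (2 + n * 3) * (k 1 ^ χ₁ (1 + n * 3) * w₁))
    ≡⟨ cong₂ _*_ (cong (k 3 ^_) (χ₁-+*3 0 n))
         (cong₂ (λ a b → k 2 ^ a * (k 1 ^ b * w₁)) (χ₁-+*3 2 n) (χ₁-+*3 1 n)) ⟩
  1 * (1 * (k 1 ^ 1 * w₁))
    ≡⟨ trans (*-identityˡ (1 * (k 1 ^ 1 * w₁))) (*-identityˡ (k 1 ^ 1 * w₁)) ⟩
  k 1 ^ 1 * w₁
    ≤⟨ *-mono-≤ (^-monoˡ-≤ 1 (n≤1+n (k 1))) (W-χ≤ n) ⟩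
  k 2 ^ 1 * w₂
    ≡⟨ trans (*-identityˡ (k 2 ^ 1 * (1 * w₂))) (cong (k 2 ^ 1 *_) (*-identityˡ w₂)) ⟨
  1 * (k 2 ^ 1 * (1 * w₂))
    ≡⟨ cong₂ _*_ (cong (k 3 ^_) (χ₂-+*3 0 n))
         (cong₂ (λ a b → k 2 ^ a * (k 1 ^ b * w₂)) (χ₂-+*3 2 n) (χ₂-+*3 1 n)) ⟨
  k 3 ^ χ₂ (n * 3) * (k 2 ^ χ₂ (2 + n * 3) * (k 1 ^ χ₂ (1 + n * 3) * w₂)) ∎
  where
  open ≤-Reasoning
  k : ℕ → ℕ
  k i = i + n * 3
  w₁ = W χ₁ (n * 3)
  w₂ = W χ₂ (n * 3)

-- Upper bound for the factorial quotient

num den : ℕ → ℕ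
num m = (m * 12) ! * ((m * 2) ! * (m ! * m !)) * W χ₂ (m * 12)
den m = (m * 6) ! * (m * 6) ! * (m * 4) ! * W χ₁ (m * 12)

!>0 : ∀ n → 0 < n !
!>0 n = >-nonZero⁻¹ (n !) {{n !≢0}}

num>0 : ∀ m → 0 < num m
num>0 m = *-mono-≤ (*-mono-≤ (!>0 (m * 12)) (*-mono-≤ (!>0 (m * 2)) (*-mono-≤ (!>0 m) (!>0 m))))
                   (W>0 χ₂ (m * 12))

den>0 : ∀ m → 0 < den m
den>0 m = *-mono-≤ (*-mono-≤ (*-mono-≤ (!>0 (m * 6)) (!>0 (m * 6))) (!>0 (m * 4))) (W>0 χ₁ (m * 12))

den*64^m≤num : ∀ m → den m * 64 ^ m ≤ num m
den*64^m≤num m = begin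
  x * W χ₁ (m * 12) * 64 ^ m                       ≡⟨ shuffle x (W χ₁ (m * 12)) (64 ^ m) ⟩
  x * 64 ^ m * W χ₁ (m * 12)
    ≤⟨ *-mono-≤ (growth m) (subst (λ n → W χ₁ n ≤ W χ₂ n) (*-assoc m 4 3) (W-χ≤ (m * 4))) ⟩
  num m                                            ∎
  where
  open ≤-Reasoning
  x = (m * 6) ! * (m * 6) ! * (m * 4) !
  shuffle : ∀ a b c → a * b * c ≡ a * c * b
  shuffle = solve-∀

module _ {p : ℕ} (pp : Prime p) where

  ν-! : ∀ n J → n < p ^ suc J → ν p (n !) ≡ ∑ (λ j → H (λ _ → 1) n (p ^ j)) J
  ν-! n J n< = trans (cong (ν p) (sym (W-const1 n))) (ν-W pp (λ _ → 1) n J n<)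

  private
    ν-*-∑ : ∀ {a b f g} J → 0 < a → 0 < b → ν p a ≡ ∑ f J → ν p b ≡ ∑ g J → ν p (a * b) ≡ ∑ (λ j → f j + g j) J
    ν-*-∑ J 0<a 0<b a≡ b≡ = trans (ν-* pp 0<a 0<b) (trans (cong₂ _+_ a≡ b≡) (∑-+ _ _ J))

  module _ (m J : ℕ) (12m< : m * 12 < p ^ suc J) where

    private
      ν-!′ : ∀ k → k ≤ 12 → ν p ((m * k) !) ≡ ∑ (λ j → H (λ _ → 1) (m * k) (p ^ j)) J
      ν-!′ k k≤12 = ν-! (m * k) J (≤-<-trans (*-monoʳ-≤ m k≤12) 12m<)

      ν-m! : ν p (m !) ≡ ∑ (λ j → H (λ _ → 1) m (p ^ j)) J
      ν-m! = ν-! m J (≤-<-trans (m≤m*n m 12) 12m<)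

    ν-num : ν p (num m) ≡ ∑ (λ j → numExp m (p ^ j)) J
    ν-num = ν-*-∑ J (*-mono-≤ (!>0 (m * 12)) (*-mono-≤ (!>0 (m * 2)) (*-mono-≤ (!>0 m) (!>0 m))))
      (W>0 χ₂ (m * 12))
      (ν-*-∑ J (!>0 (m * 12)) (*-mono-≤ (!>0 (m * 2)) (*-mono-≤ (!>0 m) (!>0 m))) (ν-!′ 12 ≤-refl)
        (ν-*-∑ J (!>0 (m * 2)) (*-mono-≤ (!>0 m) (!>0 m)) (ν-!′ 2 (≤ᵇ⇒≤ 2 12 _))
          (ν-*-∑ J (!>0 m) (!>0 m) ν-m! ν-m!)))
      (ν-W pp χ₂ (m * 12) J 12m<)

    ν-den : ν p (den m) ≡ ∑ (λ j → denExp m (p ^ j)) J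
    ν-den = ν-*-∑ J (*-mono-≤ (*-mono-≤ (!>0 (m * 6)) (!>0 (m * 6))) (!>0 (m * 4))) (W>0 χ₁ (m * 12))
      (ν-*-∑ J (*-mono-≤ (!>0 (m * 6)) (!>0 (m * 6))) (!>0 (m * 4))
        (ν-*-∑ J (!>0 (m * 6)) (!>0 (m * 6)) ν6 ν6) (ν-!′ 4 (≤ᵇ⇒≤ 4 12 _)))
      (ν-W pp χ₁ (m * 12) J 12m<)
      where ν6 = ν-!′ 6 (≤ᵇ⇒≤ 6 12 _)

    ν-num≤ : ∀ c → (∀ j → numExp m (p ^ suc j) ≤ denExp m (p ^ suc j) + c) → ν p (num m) ≤ ν p (den m) + J * c
    ν-num≤ c num≤ = begin
      ν p (num m)                                    ≡⟨ ν-num ⟩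
      ∑ (λ j → numExp m (p ^ j)) J                   ≤⟨ ∑-mono J num≤ ⟩
      ∑ (λ j → denExp m (p ^ j) + c) J               ≡⟨ ∑-+ _ _ J ⟨
      ∑ (λ j → denExp m (p ^ j)) J + ∑ (λ _ → c) J   ≡⟨ cong₂ _+_ (sym ν-den) (∑-const c J) ⟩
      ν p (den m) + J * c                            ∎
      where open ≤-Reasoning

3∣prime : ∀ a → Prime (a * 3) → a * 3 ≡ 3
3∣prime a pp with prime⇒irreducible pp {3} (divides a refl)
... | inj₂ 3≡p = sym 3≡p

^-residue₁ : ∀ a j → ∃ λ b → (1 + a * 3) ^ j ≡ 1 + b * 3
^-residue₁ a zero    = 0 , refl
^-residue₁ a (suc j) with ^-residue₁ a j
... | b , eq = b + a + a * 3 * b , trans (cong ((1 + a * 3) *_) eq) (expand a b)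
  where
  expand : ∀ a b → (1 + a * 3) * (1 + b * 3) ≡ 1 + (b + a + a * 3 * b) * 3
  expand = solve-∀

n∣n! : ∀ {k n} → 0 < k → k ≤ n → k ∣ n !
n∣n! {suc k} _ k≤n = ∣-trans (m∣m*n (k !)) (m≤n⇒m!∣n! k≤n)

-- Compare valuations. A prime p ≤ S has excess at most 2 at each of `J` powers, which is absorbed
-- because p divides S!. Above S, primes p ≡ 1 have no excess at any power; for p ≡ 2 only p itself
-- counts, as p² > 12m, and the last hypothesis removes its excess.
num≤den*[S!]^2J : ∀ m S J → m * 12 < 2 ^ suc J → 3 ≤ S → m * 12 < S * S →
  (∀ a .{{_ : NonZero (2 + a * 3)}} → Prime (2 + a * 3) → S < 2 + a * 3 → χ₁ (m * 12 / (2 + a * 3)) ≡ 0) →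
  num m ≤ den m * (S !) ^ (J * 2)
num≤den*[S!]^2J m S J 12m<2^ 3≤S 12m<S² χ₁≡0 = ν-≤⇒≤ (num>0 m) (*-mono-≤ (den>0 m) (R>0)) bound
  where
  open ≤-Reasoning
  R>0 : 0 < (S !) ^ (J * 2)
  R>0 = m^n>0 (S !) {{S !≢0}} (J * 2)

  bound : ∀ {p} → Prime p → ν p (num m) ≤ ν p (den m * (S !) ^ (J * 2))
  bound {p} pp = subst (ν p (num m) ≤_) (sym (ν-* pp (den>0 m) R>0)) (cases (p ≤? S) (mod3 p))
    where
    12m<p^ : m * 12 < p ^ suc J
    12m<p^ = <-≤-trans 12m<2^ (^-monoˡ-≤ (suc J) (prime>1 pp))
    cases : _ → Mod3 p → ν p (num m) ≤ ν p (den m) + ν p ((S !) ^ (J * 2))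
    cases (yes p≤S) _ = begin
      ν p (num m)                               ≤⟨ ν-num≤ pp m J 12m<p^ 2 residue-bound ⟩
      ν p (den m) + J * 2                       ≤⟨ +-monoʳ-≤ (ν p (den m)) (m≤m*n (J * 2) (ν p (S !))
                                                    {{>-nonZero (ν-∣ pp (!>0 S) (n∣n! (<-trans z<s (prime>1 pp)) p≤S))}}) ⟩
      ν p (den m) + J * 2 * ν p (S !)           ≡⟨ cong (ν p (den m) +_) (ν-^ pp (!>0 S) (J * 2)) ⟨
      ν p (den m) + ν p ((S !) ^ (J * 2))       ∎
      where
      residue-bound : ∀ j → numExp m (p ^ suc j) ≤ denExp m (p ^ suc j) + 2
      residue-bound j = ≤-trans (numExp≤denExp+2χ₁ m (p ^ suc j))
                                (+-monoʳ-≤ (denExp m (p ^ suc j)) (+-mono-≤ (χ₁≤1 t) (χ₁≤1 t)))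
        where
        instance _ = m^n≢0 p (suc j) {{prime⇒nonZero pp}}
        t = m * 12 / (p ^ suc j)
    cases (no p≰S) (residue₀ a) = contradiction (≤-trans (≤-reflexive (3∣prime a pp)) 3≤S) p≰S
    cases (no p≰S) (residue₁ a) = begin
      ν p (num m)                               ≤⟨ ν-num≤ pp m J 12m<p^ 0 (λ j → residue-bound (suc j)) ⟩
      ν p (den m) + J * 0                       ≤⟨ +-monoʳ-≤ (ν p (den m)) (≤-trans (≤-reflexive (*-zeroʳ J)) z≤n) ⟩
      ν p (den m) + ν p ((S !) ^ (J * 2))       ∎
      where
      residue-bound : ∀ j → numExp m ((1 + a * 3) ^ j) ≤ denExp m ((1 + a * 3) ^ j) + 0
      residue-bound j with (1 + a * 3) ^ j | ^-residue₁ a j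
      ... | _ | b , refl = ≤-trans (numExp≤denExp m b) (m≤m+n _ 0)
    cases (no p≰S) (residue₂ a) = begin
      ν p (num m)                               ≡⟨ ν-num pp m 1 12m<p² ⟩
      numExp m (p ^ 1) + 0                      ≡⟨ +-identityʳ _ ⟩
      numExp m (p ^ 1)                          ≡⟨ cong (numExp m) (*-identityʳ p) ⟩
      numExp m p                                ≤⟨ numExp≤denExp+2χ₁ m p ⟩
      denExp m p + (χ₁ (m * 12 / p) + χ₁ (m * 12 / p))
        ≡⟨ cong (λ x → denExp m p + (x + x)) (χ₁≡0 a pp (≰⇒> p≰S)) ⟩
      denExp m p + 0                            ≡⟨ cong (λ x → denExp m x + 0) (*-identityʳ p) ⟨
      denExp m (p ^ 1) + 0                      ≡⟨ ν-den pp m 1 12m<p² ⟨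
      ν p (den m)                               ≤⟨ m≤m+n _ _ ⟩
      ν p (den m) + ν p ((S !) ^ (J * 2))       ∎
      where
      12m<p² : m * 12 < p ^ 2
      12m<p² = <-trans 12m<S² (<-≤-trans (*-mono-< (≰⇒> p≰S) (≰⇒> p≰S))
                 (≤-reflexive (cong (p *_) (sym (*-identityʳ p)))))

-- The primes p ≡ 2 (mod 3) in C n

-- The third cyclotomic polynomial; `Φ₃ n` is the cofactor of n + 2 in (n + 1)³ + 1.
Φ₃ : ℕ → ℕ
Φ₃ k = k * k + k + 1

Φ₃-residue : ∀ k → (∃ λ v → Φ₃ k ≡ 1 + v * 3) ⊎ (∃ λ v → Φ₃ k ≡ (1 + v * 3) * 3)
Φ₃-residue k with mod3 k
... | residue₀ u = inj₁ (u * u * 3 + u , expand u)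
  where
  expand : ∀ u → u * 3 * (u * 3) + u * 3 + 1 ≡ 1 + (u * u * 3 + u) * 3
  expand = solve-∀
... | residue₁ u = inj₂ (u * u + u , expand u)
  where
  expand : ∀ u → (1 + u * 3) * (1 + u * 3) + (1 + u * 3) + 1 ≡ (1 + (u * u + u) * 3) * 3
  expand = solve-∀
... | residue₂ u = inj₁ (u * u * 3 + u * 5 + 2 , expand u)
  where
  expand : ∀ u → (2 + u * 3) * (2 + u * 3) + (2 + u * 3) + 1 ≡ 1 + (u * u * 3 + u * 5 + 2) * 3
  expand = solve-∀

b*3*d : ∀ b d → b * 3 * d ≡ b * d * 3
b*3*d = solve-∀

residues₁₂-disjoint : ∀ v w → 1 + v * 3 ≢ 2 + w * 3
residues₁₂-disjoint v w eq = contradiction (trans (sym (χ₂-+*3 1 v)) (trans (cong χ₂ eq) (χ₂-+*3 2 w))) λ ()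

residues₀₂-disjoint : ∀ v w → v * 3 ≢ 2 + w * 3
residues₀₂-disjoint v w eq = contradiction (trans (sym (χ₂-+*3 0 v)) (trans (cong χ₂ eq) (χ₂-+*3 2 w))) λ ()

residues₁₀-disjoint : ∀ v w → 1 + v * 3 ≢ w * 3
residues₁₀-disjoint v w eq = contradiction (trans (sym (χ₁-+*3 1 v)) (trans (cong χ₁ eq) (χ₁-+*3 0 w))) λ ()

[1+b*3]*[2+a*3] : ∀ b a → (1 + b * 3) * (2 + a * 3) ≡ 2 + (a + b * 2 + a * b * 3) * 3
[1+b*3]*[2+a*3] = solve-∀

-- Descent on the divisor d, which need not be prime. Reducing k to r modulo d gives Φ₃ r = c d with
-- c < d. Since Φ₃ r is 1 modulo 3, or 3 times such a number, c or c / 3 is a smaller divisor ≡ 2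
-- (mod 3).
residue₂∤Φ₃ : ∀ a k → ¬ 2 + a * 3 ∣ Φ₃ k
residue₂∤Φ₃ a = go (suc a) a ≤-refl
  where
  go : ∀ bound a → a < bound → ∀ k → ¬ 2 + a * 3 ∣ Φ₃ k
  go (suc bound) a a<bound k d∣Φk = descend
    where
    d = 2 + a * 3
    r = k % d
    Φ₃-shift : ∀ r q d → (r + q * d) * (r + q * d) + (r + q * d) + 1
             ≡ q * (r + r + q * d + 1) * d + (r * r + r + 1)
    Φ₃-shift = solve-∀
    d∣Φr : d ∣ Φ₃ r
    d∣Φr = ∣m+n∣m⇒∣n (subst (d ∣_) (trans (cong Φ₃ (m≡m%n+[m/n]*n k d)) (Φ₃-shift r (k / d) d)) d∣Φk)
                    (n∣m*n (k / d * (r + r + k / d * d + 1)))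
    c = quotient d∣Φr
    Φr≡ : Φ₃ r ≡ c * d
    Φr≡ = m∣n⇒n≡quotient*m d∣Φr
    Φr<d² : Φ₃ r < d * d
    Φr<d² = begin-strict
      Φ₃ r                       ≤⟨ +-monoˡ-≤ 1 (+-mono-≤ (*-mono-≤ r≤ r≤) r≤) ⟩
      Φ₃ (1 + a * 3)             <⟨ s≤s (m≤m+n _ (a * 3)) ⟩
      suc (Φ₃ (1 + a * 3) + a * 3) ≡⟨ expand (a * 3) ⟩
      d * d                      ∎
      where
      open ≤-Reasoning
      r≤ : r ≤ 1 + a * 3
      r≤ = ≤-pred (m%n<n k d)
      expand : ∀ e → suc ((1 + e) * (1 + e) + (1 + e) + 1 + e) ≡ (2 + e) * (2 + e)
      expand = solve-∀
    c<d : c < d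
    c<d = *-cancelʳ-< d c d (subst (_< d * d) Φr≡ Φr<d²)
    recurse : ∀ b → 2 + b * 3 < d → ¬ 2 + b * 3 ∣ Φ₃ r
    recurse b b<d = go bound b (<-≤-trans (*-cancelʳ-< 3 b a (+-cancelˡ-< 2 (b * 3) (a * 3) b<d))
                                      (≤-pred a<bound)) r
    cases : ∀ {c} → Mod3 c → c < d → ¬ Φ₃ r ≡ c * d
    cases (residue₂ b) c<d eq = recurse b c<d (subst (2 + b * 3 ∣_) (sym eq) (m∣m*n d))
    cases (residue₁ b) c<d eq with Φ₃-residue r
    ... | inj₁ (v , Φ≡) = residues₁₂-disjoint v (a + b * 2 + a * b * 3)
                            (trans (sym Φ≡) (trans eq ([1+b*3]*[2+a*3] b a)))
    ... | inj₂ (v , Φ≡) = residues₀₂-disjoint (1 + v * 3) (a + b * 2 + a * b * 3)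
                            (trans (sym Φ≡) (trans eq ([1+b*3]*[2+a*3] b a)))
    cases (residue₀ b) c<d eq with Φ₃-residue r
    ... | inj₁ (v , Φ≡) = residues₁₀-disjoint v (b * d) (trans (sym Φ≡) (trans eq (b*3*d b d)))
    -- Here c = 3b; cancelling 3 leaves b d ≡ 1 (mod 3), which forces b ≡ 2.
    ... | inj₂ (v , Φ≡) = cofactor (mod3 b)
      (*-cancelʳ-≡ (b * d) (1 + v * 3) 3 (trans (sym (b*3*d b d)) (trans (sym eq) Φ≡)))
      (≤-<-trans (m≤m*n b 3) c<d) b∣Φ
      where
      b∣Φ : b ∣ Φ₃ r
      b∣Φ = subst (b ∣_) (sym eq) (∣m⇒∣m*n d (m∣m*n 3))
      cofactor : ∀ {b} → Mod3 b → b * d ≡ 1 + v * 3 → b < d → ¬ b ∣ Φ₃ r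
      cofactor (residue₂ b) _ b<d b∣Φ = recurse b b<d b∣Φ
      cofactor (residue₁ b) eq _ _ = residues₁₂-disjoint v (a + b * 2 + a * b * 3)
                                       (trans (sym eq) ([1+b*3]*[2+a*3] b a))
      cofactor (residue₀ b) eq _ _ = residues₁₀-disjoint v (b * d) (trans (sym eq) (b*3*d b d))
    descend = cases (mod3 c) c<d Φr≡

C>0 : ∀ n → 0 < C n
C>0 zero    = z<s
C>0 (suc n) = *-mono-≤ (C>0 n) (m≤n+m 1 (suc n ^ 3))

module _ (a : ℕ) (pp : Prime (2 + a * 3)) where

  private p = 2 + a * 3

  -- Each factor of `C n` splits as n + 2 times `Φ₃ n` after the shift of index, and the second part
  -- is prime to p.
  ν-C : ∀ n → ν p (C n) ≡ ν p (suc n !)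
  ν-C zero    = refl
  ν-C (suc n) = begin
    ν p (C n * (suc n ^ 3 + 1))                  ≡⟨ cong (λ x → ν p (C n * x)) (factor n) ⟩
    ν p (C n * ((2 + n) * Φ₃ n))                 ≡⟨ ν-* pp (C>0 n) (*-mono-≤ (z<s {suc n}) Φ₃>0) ⟩
    ν p (C n) + ν p ((2 + n) * Φ₃ n)             ≡⟨ cong₂ _+_ (ν-C n) (ν-* pp (z<s {suc n}) Φ₃>0) ⟩
    ν p (suc n !) + (ν p (2 + n) + ν p (Φ₃ n))
      ≡⟨ cong (λ x → ν p (suc n !) + (ν p (2 + n) + x)) (ν-∤ pp Φ₃>0 (residue₂∤Φ₃ a n)) ⟩
    ν p (suc n !) + (ν p (2 + n) + 0)            ≡⟨ cong (ν p (suc n !) +_) (+-identityʳ _) ⟩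
    ν p (suc n !) + ν p (2 + n)                  ≡⟨ +-comm (ν p (suc n !)) _ ⟩
    ν p (2 + n) + ν p (suc n !)                  ≡⟨ ν-* pp (z<s {suc n}) (!>0 (suc n)) ⟨
    ν p (suc (suc n) !)                          ∎
    where
    open ≡-Reasoning
    Φ₃>0 : 0 < Φ₃ n
    Φ₃>0 = m≤n+m 1 (n * n + n)
    factor : ∀ n → (1 + n) * ((1 + n) * ((1 + n) * 1)) + 1 ≡ (2 + n) * (n * n + n + 1)
    factor = solve-∀

  -- As p² exceeds n + 1, the valuation of (n + 1)! is the single quotient (n + 1) / p, while that
  -- of a cube is a multiple of 3.
  cube⇒quotient : ∀ n k → k ^ 3 ≡ C n → suc n < p * p → ∃ λ x → suc n / p ≡ x * 3
  cube⇒quotient n zero    eq _ = contradiction eq (<⇒≢ (C>0 n))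
  cube⇒quotient n k@(suc _) eq n<p² = ν p k , (begin
    suc n / p                          ≡⟨ H-factorial (suc n) p ⟨
    H (λ _ → 1) (suc n) p              ≡⟨ cong (H (λ _ → 1) (suc n)) (*-identityʳ p) ⟨
    H (λ _ → 1) (suc n) (p ^ 1)        ≡⟨ +-identityʳ _ ⟨
    H (λ _ → 1) (suc n) (p ^ 1) + 0    ≡⟨ ν-! pp (suc n) 1 (subst (suc n <_) (cong (p *_) (sym (*-identityʳ p))) n<p²) ⟨
    ν p (suc n !)                      ≡⟨ ν-C n ⟨
    ν p (C n)                          ≡⟨ cong (ν p) eq ⟨
    ν p (k ^ 3)                        ≡⟨ ν-^ pp {k} z<s 3 ⟩
    3 * ν p k                          ≡⟨ *-comm 3 (ν p k) ⟩
    ν p k * 3                          ∎)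
    where open ≡-Reasoning

  not-cube : ∀ n → p ≤ suc n → suc n < 3 * p → suc n < p * p → ∀ k → ¬ k ^ 3 ≡ C n
  not-cube n p≤N N<3p N<p² k eq with cube⇒quotient n k eq N<p²
  ... | zero  , q≡ = contradiction (m/n≡0⇒m<n q≡) (≤⇒≯ p≤N)
  ... | suc x , q≡ = contradiction (m<n*o⇒m/o<n {suc n} {3} {p} N<3p)
                                     (≤⇒≯ (subst (3 ≤_) (sym q≡) (m≤m+n 3 (x * 3))))

-- Small and large n

-- Tests the divisors from 2 to k + 1; being Boolean, it settles the primality of numerals by
-- evaluation.
indivisible : ℕ → ℕ → Bool
indivisible n zero    = true
indivisible n (suc k) = not (n % (2 + k) ≡ᵇ 0) ∧ indivisible n k

indivisible⇒rough : ∀ n k → T (indivisible n k) → (2 + k) Rough n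
indivisible⇒rough n zero    t = 2-rough
indivisible⇒rough n (suc k) t with Equivalence.to T-∧ t
... | t₁ , t₂ = ∤⇒rough-suc (λ d∣n → absurd (n∣m⇒m%n≡0 n (2 + k) d∣n) t₁) (indivisible⇒rough n k t₂)
  where
  absurd : ∀ {r} → r ≡ 0 → ¬ T (not (r ≡ᵇ 0))
  absurd refl ()

trial-division : ∀ n k .{{_ : NonTrivial n}} → T (indivisible n k) → T (n <ᵇ (2 + k) * (2 + k)) → Prime n
trial-division n k t n<k² = rough∧square>⇒prime (indivisible⇒rough n k t) (<ᵇ⇒< n _ n<k²)

NoCubeBelow : ℕ → Set
NoCubeBelow b = ∀ n → 1 ≤ n → suc n < b → ∀ k → ¬ k ^ 3 ≡ C n

no-cube-below-5 : NoCubeBelow 5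
no-cube-below-5 1 _ _ = not-cube 0 prime[2] 1 (≤ᵇ⇒≤ 2 2 _) (≤ᵇ⇒≤ 3 6 _) (≤ᵇ⇒≤ 3 4 _)
no-cube-below-5 2 _ _ = not-cube 0 prime[2] 2 (≤ᵇ⇒≤ 2 3 _) (≤ᵇ⇒≤ 4 6 _) (≤ᵇ⇒≤ 4 4 _)
-- The prime 2 fails here, since 2² is not above N = 4; instead 7³ < C 3 = 504 < 8³.
no-cube-below-5 3 _ _ k eq with k ≤? 7
... | yes k≤7 = contradiction eq (<⇒≢ (≤-<-trans (^-monoˡ-≤ 3 k≤7) (≤ᵇ⇒≤ 344 504 _)))
... | no  k≰7 = contradiction (sym eq) (<⇒≢ (<-≤-trans (≤ᵇ⇒≤ 505 512 _) (^-monoˡ-≤ 3 (≰⇒> k≰7))))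
no-cube-below-5 (suc (suc (suc (suc n)))) _ (s≤s (s≤s (s≤s (s≤s (s≤s ())))))

-- A prime p ≤ b excludes all N in [p, 3p), and p ≥ 3 supplies N < p². Smaller N are covered
-- already.
extend : ∀ {b} a k → let p = 2 + a * 3 in
         {_ : T (indivisible p k)} {_ : T (p <ᵇ (2 + k) * (2 + k))} {_ : T (p ≤ᵇ b)} {_ : T (3 ≤ᵇ p)} →
         NoCubeBelow b → NoCubeBelow (3 * p)
extend {b} a k {t₁} {t₂} {t₃} {t₄} below n 1≤n n<3p with suc n <? 2 + a * 3
... | yes n<p = below n 1≤n (<-≤-trans n<p (≤ᵇ⇒≤ (2 + a * 3) b t₃))
... | no  n≮p = not-cube a (trial-division (2 + a * 3) k t₁ t₂) n (≮⇒≥ n≮p) n<3p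
                  (<-≤-trans n<3p (*-monoˡ-≤ (2 + a * 3) (≤ᵇ⇒≤ 3 (2 + a * 3) t₄)))

-- The arguments a run over primes 2 + 3a, from 5 to 13727981, each less than three times the one before;
-- the second argument bounds the trial divisors.
no-cube-below-3*13727981 : NoCubeBelow (3 * 13727981)
no-cube-below-3*13727981 =
  extend 4575993 3704 $
  extend 1525333 2138 $
  extend 508447 1234 $
  extend 169483 712 $
  extend 56497 410 $
  extend 18833 236 $
  extend 6279 136 $
  extend 2095 78 $
  extend 699 44 $
  extend 233 25 $
  extend 79 14 $
  extend 27 8 $
  extend 9 4 $
  extend 3 2 $
  extend 1 1 $
  no-cube-below-5

-- Comparison of the two bounds for large N

2^[n*2] : ∀ n → 2 ^ (n * 2) ≡ 4 ^ n
2^[n*2] n = trans (cong (2 ^_) (*-comm n 2)) (sym (^-*-assoc 2 2 n))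

2^n*2^n : ∀ n → 2 ^ n * 2 ^ n ≡ 4 ^ n
2^n*2^n n = trans (sym (^-distribˡ-+-* 2 n n))
  (trans (cong (2 ^_) (trans (cong (n +_) (sym (+-identityʳ n))) (*-comm 2 n))) (2^[n*2] n))

n!≤b^n : ∀ {b} n → n ≤ b → n ! ≤ b ^ n
n!≤b^n zero    _   = ≤-refl
n!≤b^n (suc n) n<b = *-mono-≤ n<b (n!≤b^n n (<⇒≤ n<b))

-- The final numerical comparison needs this bound; 12 is the least h satisfying it, whence the
-- threshold 4¹².
quadratic≤2^ : ∀ i → let h = i + 12 in 8 * ((1 + h) * (1 + h * 2)) + 1 ≤ 2 ^ h
quadratic≤2^ zero    = ≤ᵇ⇒≤ 2601 4096 _
quadratic≤2^ (suc i) = ≤-trans (m+n≤o⇒m≤o _ (≤-reflexive (expand i))) (*-monoʳ-≤ 2 (quadratic≤2^ i))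
  where
  expand : ∀ i → 8 * ((1 + (1 + (i + 12))) * (1 + (1 + (i + 12)) * 2)) + 1 + (16 * i * i + 376 * i + 2177)
               ≡ 2 * (8 * ((1 + (i + 12)) * (1 + (i + 12) * 2)) + 1)
  expand = solve-∀

log₄ : ∀ n → 1 ≤ n → ∃ λ h → 4 ^ h ≤ n × n < 4 ^ suc h
log₄ 1 _ = 0 , ≤-refl , ≤ᵇ⇒≤ 2 4 _
log₄ (suc n@(suc _)) _ with log₄ n z<s
... | h , 4^h≤n , n<4^[1+h] with suc n <? 4 ^ suc h
...   | yes 1+n< = h , m≤n⇒m≤1+n 4^h≤n , 1+n<
...   | no  1+n≮ = suc h , ≮⇒≥ 1+n≮ , ≤-<-trans n<4^[1+h] (^-monoʳ-< 4 (≤ᵇ⇒≤ 2 4 _) (n<1+n (suc h)))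

module Large (n h : ℕ) (12≤h : 12 ≤ h) (4^h≤N : 4 ^ h ≤ suc n) (N<4^[1+h] : suc n < 4 ^ suc h) where

  -- `S` is a power of 2 with √N < S ≤ 2√N, and `J` is such that 2^(J + 1) = 4^(h + 1) > N.
  N m r S J : ℕ
  N = suc n
  m = N / 12
  r = N % 12
  S = 2 ^ suc h
  J = 1 + h * 2

  N≡ : N ≡ r + m * 12
  N≡ = m≡m%n+[m/n]*n N 12

  12m≤N : m * 12 ≤ N
  12m≤N = m/n*n≤m N 12

  N<S² : N < S * S
  N<S² = subst (N <_) (sym (2^n*2^n (suc h))) N<4^[1+h]

  h<2^h : h < 2 ^ h
  h<2^h = n<p^n prime[2] h

  12≤S : 12 ≤ S
  12≤S = ≤-trans 12≤h (≤-trans (<⇒≤ h<2^h) (m≤n*m (2 ^ h) 2))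

  E : ℕ
  E = suc h * (S * (J * 2))

  [S!]^2J≤2^E : (S !) ^ (J * 2) ≤ 2 ^ E
  [S!]^2J≤2^E = begin
    (S !) ^ (J * 2)     ≤⟨ ^-monoˡ-≤ (J * 2) (n!≤b^n S ≤-refl) ⟩
    (S ^ S) ^ (J * 2)   ≡⟨ ^-*-assoc S S (J * 2) ⟩
    S ^ (S * (J * 2))   ≡⟨ ^-*-assoc 2 (suc h) (S * (J * 2)) ⟩
    2 ^ E               ∎
    where open ≤-Reasoning

  E<6m : E < 6 * m
  E<6m = *-cancelʳ-< 2 E (6 * m) (+-cancelˡ-< r (E * 2) (6 * m * 2) (begin-strict
    -- Adding `r` to both sides replaces 12m by N, which is at least 4^h.
    r + E * 2
      <⟨ +-monoˡ-< (E * 2) (<-trans (<-≤-trans (m%n<n N 12) 12≤h) h<2^h) ⟩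
    2 ^ h + E * 2                                        ≡⟨ shuffle h (2 ^ h) ⟩
    (8 * (suc h * (1 + h * 2)) + 1) * 2 ^ h
      ≤⟨ *-monoˡ-≤ (2 ^ h) (subst (λ h → 8 * (suc h * (1 + h * 2)) + 1 ≤ 2 ^ h) (m∸n+n≡m 12≤h)
           (quadratic≤2^ (h ∸ 12))) ⟩
    2 ^ h * 2 ^ h                                        ≡⟨ 2^n*2^n h ⟩
    4 ^ h                                                ≤⟨ 4^h≤N ⟩
    N                                                    ≡⟨ N≡ ⟩
    r + m * 12                                           ≡⟨ cong (r +_) (shuffle′ m) ⟩
    r + 6 * m * 2                                        ∎))
    where
    open ≤-Reasoning
    shuffle : ∀ h x → x + suc h * (2 * x * ((1 + h * 2) * 2)) * 2 ≡ (8 * (suc h * (1 + h * 2)) + 1) * x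
    shuffle = solve-∀
    shuffle′ : ∀ m → m * 12 ≡ 6 * m * 2
    shuffle′ = solve-∀

  module _ (k : ℕ) (k³≡C : k ^ 3 ≡ C n) where

    -- `N / p` is a multiple of 3. As r < p, passing from N to 12m lowers the quotient by at most 1,
    -- so it becomes 0 or 2 modulo 3, never 1.
    χ₁≡0 : ∀ a .{{_ : NonZero (2 + a * 3)}} → Prime (2 + a * 3) → S < 2 + a * 3 → χ₁ (m * 12 / (2 + a * 3)) ≡ 0
    χ₁≡0 a pp S<p with cube⇒quotient a pp n k k³≡C (<-trans N<S² (*-mono-< S<p S<p))
    ... | x , q≡ with m≤n⇒m<n∨m≡n (/-monoˡ-≤ (2 + a * 3) 12m≤N)
    ...   | inj₂ t≡q = trans (cong χ₁ (trans t≡q q≡)) (χ₁-+*3 0 x)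
    ...   | inj₁ t<q = trans (sym (χ₂-suc t)) (trans (cong χ₂ (trans (≤-antisym t<q q≤1+t) q≡)) (χ₂-+*3 0 x))
      where
      p = 2 + a * 3
      t = m * 12 / p
      q≤1+t : N / p ≤ suc t
      q≤1+t = ≤-pred (m<n*o⇒m/o<n {N} {2 + t} {p} (begin-strict
        N                               ≡⟨ N≡ ⟩
        r + m * 12                      <⟨ +-mono-< (<-trans (<-≤-trans (m%n<n N 12) 12≤S) S<p) 12m<[1+t]p ⟩
        p + (p + t * p)                 ∎))
        where
        open ≤-Reasoning
        12m<[1+t]p : m * 12 < p + t * p
        12m<[1+t]p = subst (_< p + t * p) (sym (m≡m%n+[m/n]*n (m * 12) p))
                             (+-monoˡ-< (t * p) (m%n<n (m * 12) p))

    64^m≤2^E : 64 ^ m ≤ 2 ^ E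
    64^m≤2^E = ≤-trans (*-cancelˡ-≤ (den m) {{>-nonZero (den>0 m)}} (≤-trans (den*64^m≤num m)
      (num≤den*[S!]^2J m S J 12m<2^[1+J] (≤-trans (≤ᵇ⇒≤ 3 12 _) 12≤S) (≤-<-trans 12m≤N N<S²) χ₁≡0))) [S!]^2J≤2^E
      where
      12m<2^[1+J] : m * 12 < 2 ^ suc J
      12m<2^[1+J] = ≤-<-trans 12m≤N (subst (N <_) (sym (2^[n*2] (suc h))) N<4^[1+h])

    contradicts-bounds : ⊥
    contradicts-bounds = <⇒≱ (^-monoʳ-< 2 (≤ᵇ⇒≤ 2 2 _) E<6m) (subst (_≤ 2 ^ E) (^-*-assoc 2 6 m) 64^m≤2^E)

no-cube : ∀ n → 1 ≤ n → ∀ k → ¬ k ^ 3 ≡ C n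
no-cube n 1≤n k eq with log₄ (suc n) z<s
... | h , 4^h≤N , N<4^[1+h] with 12 ≤? h
...   | yes 12≤h = Large.contradicts-bounds n h 12≤h 4^h≤N N<4^[1+h] k eq
...   | no  12≰h = no-cube-below-3*13727981 n 1≤n (<-≤-trans N<4^[1+h]
                     (≤-trans (^-monoʳ-≤ 4 (≰⇒> 12≰h)) (≤ᵇ⇒≤ (4 ^ 12) (3 * 13727981) _))) k eq

-- Passes from an integer cube root, possibly negative, to a natural one.
∣i³∣ : ∀ i → ∣ i ℤ.^ 3 ∣ ≡ ∣ i ∣ ^ 3
∣i³∣ i = trans (abs-* i (i ℤ.^ 2))
  (cong (∣ i ∣ *_) (trans (abs-* i (i ℤ.^ 1)) (cong (∣ i ∣ *_) (abs-* i (ℤ.+ 1)))))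

theorem1p1 : (n : ℕ) → n ≥ 1 → ¬ (∃ λ (m : ℤ) → m ℤ.^ 3 ≡ ℤ.+ C n)
theorem1p1 n n≥1 (m , m³≡C) = no-cube n n≥1 ∣ m ∣ (trans (sym (∣i³∣ m)) (cong ∣_∣ m³≡C))
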